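{- $\mathsf{L/quasipoly} \supseteq \mathsf{NL/poly}$.
   Context: $\mathsf{L/poly}$ (resp. $\mathsf{NL/poly}$) is the class of decision problems solvable by a deterministic (resp. nondeterministic) $O(\log n)$-space Turing machine with advice of size polynomial in the input length $n$. $\mathsf{L/quasipoly}$ is the class of decision problems solvable by a deterministic $O(\log n)$-space Turing machine with advice of quasipolynomial size, i.e. size $2^{(\log n)^{O(1)}}$. -}

module Defs where

open import Data.Nat using (ℕ; zero; suc; _+_; _*_; _^_; _≤_; _<?_)
open import Data.Nat.Logarithm using (⌊log₂_⌋)
open import Data.Bool using (Bool; true; false; if_then_else_)
open import Data.Maybe using (Maybe; just; nothing)
open import Data.List using (List; []; _∷_; length)
open import Data.List.Membership.Propositional using (_∈_)
open import Data.Fin using (Fin)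
open import Data.Product using (Σ; ∃; _×_; _,_)
open import Relation.Nullary using (yes; no)
open import Relation.Binary.PropositionalEquality using (_≡_)
open import Relation.Binary.Construct.Closure.ReflexiveTransitive using (Star)

-- Machine model: a Turing machine with
--   * a two-way read-only INPUT tape holding x,
--   * a two-way read-only ADVICE tape holding the advice string,
--   * one read/write binary WORK tape (all cells initially false).
-- Reading a read-only tape outside the string yields 'nothing'
-- (acts as endmarker); read-only heads are confined to positions
-- 0 .. length (they cannot move past the right endmarker), and their
-- positions are not charged as space (standard convention).
-- Space used = positions of the work head.

data Move : Set where
  L S R : Move

moveRO : ℕ → Move → ℕ → ℕ
moveRO b L zero    = zero
moveRO b L (suc p) = p
moveRO b S p       = p
moveRO b R p with p <? b
... | yes _ = suc p
... | no  _ = p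

moveW : Move → ℕ → ℕ
moveW L zero    = zero
moveW L (suc p) = p
moveW S p       = p
moveW R p       = suc p

readRO : List Bool → ℕ → Maybe Bool
readRO []       _       = nothing
readRO (b ∷ bs) zero    = just b
readRO (b ∷ bs) (suc p) = readRO bs p

write : (ℕ → Bool) → ℕ → Bool → (ℕ → Bool)
write t p b i with i Data.Nat.≟ p
... | yes _ = b
... | no  _ = t i

-- A (possibly nondeterministic) machine.  On (state, input symbol,
-- advice symbol, work symbol) it may choose any transition from the
-- list: (new state, symbol written on work tape,
--         input-head move, advice-head move, work-head move).
record TM : Set where
  field
    Q         : ℕ
    start     : Fin Q
    accepting : Fin Q → Bool
    δ         : Fin Q → Maybe Bool → Maybe Bool → Bool →
                List (Fin Q × Bool × Move × Move × Move)
open TM public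

Deterministic : TM → Set
Deterministic M = ∀ q a b c → length (δ M q a b c) ≤ 1

record Config (M : TM) : Set where
  constructor cfg
  field
    state : Fin (Q M)
    ihead : ℕ
    ahead : ℕ
    whead : ℕ
    tape  : ℕ → Bool
open Config public

initial : (M : TM) → Config M
initial M = cfg (start M) 0 0 0 (λ _ → false)

data Step (M : TM) (x a : List Bool) : Config M → Config M → Set where
  step : ∀ {q i h w t q' b mi ma mw} →
         (q' , b , mi , ma , mw) ∈ δ M q (readRO x i) (readRO a h) (t w) →
         Step M x a (cfg q i h w t)
                    (cfg q' (moveRO (length x) mi i) (moveRO (length a) ma h)
                            (moveW mw w) (write t w b))

Reachable : (M : TM) → List Bool → List Bool → Config M → Set
Reachable M x a C = Star (Step M x a) (initial M) C

Accepts : TM → List Bool → List Bool → Set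
Accepts M x a = ∃ λ C → Reachable M x a C × accepting M (state C) ≡ true

Language : Set₁
Language = List Bool → Set

LogSpaceWith : TM → ℕ → (ℕ → List Bool) → Set
LogSpaceWith M c α =
  ∀ x C → Reachable M x (α (length x)) C →
    whead C ≤ c * ⌊log₂ length x ⌋ + c

Decides : TM → (ℕ → List Bool) → Language → Set
Decides M α A = ∀ x → (A x → Accepts M x (α (length x)))
                    × (Accepts M x (α (length x)) → A x)

PolyBound : ℕ → ℕ → ℕ
PolyBound c n = n ^ c + c

QuasiPolyBound : ℕ → ℕ → ℕ
QuasiPolyBound c n = 2 ^ ((⌊log₂ n ⌋ + 1) ^ c)

InNLpoly : Language → Set
InNLpoly A = Σ TM λ M → Σ ℕ λ c → Σ (ℕ → List Bool) λ α →
  (∀ n → length (α n) ≤ PolyBound c n) × LogSpaceWith M c α × Decides M α A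

InLquasipoly : Language → Set
InLquasipoly A = Σ TM λ M → Σ ℕ λ c → Σ (ℕ → List Bool) λ α →
  Deterministic M ×
  (∀ n → length (α n) ≤ QuasiPolyBound c n) × LogSpaceWith M c α × Decides M α A

{-# OPTIONS --safe #-}
module Submission where

-- Savitch's midpoint recursion turns reachability between the configurations
-- of a logspace machine with polynomial advice into a formula over the input
-- bits of depth O(log² n).  By Ben-Or and Cleve, such a formula over GF(2) is
-- computed by a straight-line program of length 2^O(log² n) on three one-bit
-- registers: with the registers p, q, r, adding q·f to r, r·g to p, q·f to r
-- and r·g to p has the net effect of adding q·f·g to p.  The program is the
-- quasi-polynomial advice.  Addresses of input bits are written in it as unary
-- head moves, so a finite automaton reading the advice once executes it and
-- the work tape stays unused.

open import Defs

open import Data.Bool using (Bool; true; false; if_then_else_; not; _∧_; _∨_; _xor_)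
open import Data.Bool.Properties using (∧-zeroʳ; xor-identityʳ) renaming (_≟_ to _≟ᵇ_)
open import Data.Bool.Solver using (module xor-∧-Solver)
open import Data.Fin using (Fin; zero; suc; combine; toℕ; fromℕ<)
open import Data.Fin.Patterns
open import Data.Fin.Properties
  using (combine-injective; injective⇒≤; toℕ<n; toℕ-fromℕ<; fromℕ<-toℕ;
         1↔⊤; 2↔Bool; +↔⊎; *↔×)
open import Data.List using (List; []; _∷_; _++_; drop; length; lookup; map; replicate)
open import Data.List.Membership.Propositional using (_∈_)
open import Data.List.Membership.Propositional.Properties using (∈-lookup; ∈-map⁺; ∈-map⁻)
open import Data.List.Properties using (length-++; length-replicate; map-cong; map-∘)
open import Data.List.Relation.Unary.All.Properties using (¬Any⇒All¬; All¬⇒¬Any)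
open import Data.List.Relation.Unary.AllPairs using ([]; _∷_)
open import Data.List.Relation.Unary.Any using (here; there)
open import Data.List.Relation.Unary.Unique.Propositional using (Unique)
open import Data.Maybe using (Maybe; just; nothing; fromMaybe)
open import Data.Nat
open import Data.Nat.DivMod using (_/_; _%_; m≡m%n+[m/n]*n; m%n<n; m<n*o⇒m/o<n)
open import Data.Nat.Logarithm using (⌊log₂_⌋; ⌊log₂⌋-mono-≤; ⌊log₂[2^n]⌋≡n)
open import Data.Nat.Properties
open import Data.Nat.Solver using (module +-*-Solver)
open import Data.Product using (∃-syntax; _×_; _,_; proj₁; proj₂)
open import Data.Product.Function.NonDependent.Propositional using (_×-↔_)
open import Data.Sum using (_⊎_; inj₁; inj₂)
open import Data.Sum.Function.Propositional using (_⊎-↔_)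
open import Data.Unit using (⊤; tt)
open import Data.Vec using (Vec; []; _∷_) renaming (_++_ to _⧺_; take to takeᵛ; drop to dropᵛ)
open import Data.Vec.Properties using (≡-dec)
open import Function using (_∘_; Injective; _↔_; Inverse; _⇔_; mk⇔; Equivalence)
open import Function.Properties.Inverse using (↔-trans)
open import Relation.Binary.Construct.Closure.ReflexiveTransitive
  using (Star; ε; _◅_; _◅◅_)
open import Relation.Binary.Definitions using (DecidableEquality)
open import Relation.Binary.PropositionalEquality
open import Relation.Nullary using (¬_; Dec; yes; no; contradiction)
open import Relation.Nullary.Decidable using (⌊_⌋)
import Data.List.Membership.DecPropositional as DecMembership

-- Straight-line programs for formulas

data Formula (n : ℕ) : Set where
  const   : Bool → Formula n
  var     : Fin n → Formula n
  _⊕_ _⊗_ : Formula n → Formula n → Formula n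

infixl 6 _⊕_
infixl 7 _⊗_

eval : ∀ {n} → Formula n → List Bool → Bool
eval (const b) x = b
eval (var k)   x = fromMaybe false (readRO x (toℕ k))
eval (F ⊕ G)   x = eval F x xor eval G x
eval (F ⊗ G)   x = eval F x ∧ eval G x

Registers : Set
Registers = Bool × Bool × Bool

-- A target register and an orientation determine the source register,
-- the next one cyclically for false and the previous one for true.
addTo : Fin 3 → Bool → Bool → Registers → Registers
addTo 0F false b (p , q , r) = p xor (q ∧ b) , q , r
addTo 0F true  b (p , q , r) = p xor (r ∧ b) , q , r
addTo 1F false b (p , q , r) = p , q xor (r ∧ b) , r
addTo 1F true  b (p , q , r) = p , q xor (p ∧ b) , r
addTo 2F false b (p , q , r) = p , q , r xor (p ∧ b)
addTo 2F true  b (p , q , r) = p , q , r xor (q ∧ b)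

-- The register that is neither target nor source; a product uses it as scratch space whose contents
-- are arbitrary and later restored.
third : Fin 3 → Bool → Fin 3
third 0F false = 2F
third 0F true  = 1F
third 1F false = 0F
third 1F true  = 2F
third 2F false = 1F
third 2F true  = 0F

data Instr : Set where
  add     : Fin 3 → Bool → Instr
  addBit  : Fin 3 → Bool → Instr
  ◂ ▸     : Instr

update : Instr → Maybe Bool → Registers → Registers
update (add t o)    s ρ = addTo t o true ρ
update (addBit t o) s ρ = addTo t o (fromMaybe false s) ρ
update ◂            s ρ = ρ
update ▸            s ρ = ρ

shift : Instr → Move
shift (add _ _)    = S
shift (addBit _ _) = S
shift ◂            = L
shift ▸            = R

run : List Bool → List Instr → Registers × ℕ → Registers × ℕ
run x []      c       = c
run x (ι ∷ p) (ρ , i) =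
  run x p (update ι (readRO x i) ρ , moveRO (length x) (shift ι) i)

compile : ∀ {n} → Formula n → Fin 3 → Bool → List Instr
compile (const false) t o = []
compile (const true)  t o = add t o ∷ []
-- Out and back: a compiled program started with the input head at 0 ends with it at 0, so programs
-- can be concatenated.
compile (var k)       t o =
  replicate (toℕ k) ▸ ++ addBit t o ∷ replicate (toℕ k) ◂
compile (F ⊕ G)       t o = compile F t o ++ compile G t o
compile (F ⊗ G)       t o =
  -- Under the flipped orientation the third register receives from the original source, and the
  -- target receives from the third register.
  let f = compile F (third t o) (not o)
      g = compile G t (not o)
  in f ++ g ++ f ++ g

xor-merge : ∀ p q b c → (p xor (q ∧ b)) xor (q ∧ c) ≡ p xor (q ∧ (b xor c))
xor-merge = solve 4
  (λ p q b c → (p :+ q :* b) :+ q :* c := p :+ q :* (b :+ c)) refl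
  where open xor-∧-Solver using (solve; _:+_; _:*_; _:=_)

xor-restore : ∀ r a → (r xor a) xor a ≡ r
xor-restore = solve 2 (λ r a → (r :+ a) :+ a := r) refl
  where open xor-∧-Solver using (solve; _:+_; _:*_; _:=_)

-- The two additions into `p` contribute `(r + qb)c` and `rc`; modulo 2 the unknown term `rc`
-- cancels and `qbc` remains.
xor-commutator : ∀ p q r b c →
  (p xor ((r xor (q ∧ b)) ∧ c)) xor (((r xor (q ∧ b)) xor (q ∧ b)) ∧ c)
    ≡ p xor (q ∧ (b ∧ c))
xor-commutator = solve 5
  (λ p q r b c →
    (p :+ (r :+ q :* b) :* c) :+ ((r :+ q :* b) :+ q :* b) :* c
      := p :+ q :* (b :* c)) refl
  where open xor-∧-Solver using (solve; _:+_; _:*_; _:=_)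

addTo-false : ∀ t o ρ → addTo t o false ρ ≡ ρ
addTo-false 0F false (p , q , r) rewrite ∧-zeroʳ q = cong (λ z → z , q , r) (xor-identityʳ p)
addTo-false 0F true  (p , q , r) rewrite ∧-zeroʳ r = cong (λ z → z , q , r) (xor-identityʳ p)
addTo-false 1F false (p , q , r) rewrite ∧-zeroʳ r = cong (λ z → p , z , r) (xor-identityʳ q)
addTo-false 1F true  (p , q , r) rewrite ∧-zeroʳ p = cong (λ z → p , z , r) (xor-identityʳ q)
addTo-false 2F false (p , q , r) rewrite ∧-zeroʳ p = cong (λ z → p , q , z) (xor-identityʳ r)
addTo-false 2F true  (p , q , r) rewrite ∧-zeroʳ q = cong (λ z → p , q , z) (xor-identityʳ r)

addTo-xor : ∀ t o b c ρ → addTo t o c (addTo t o b ρ) ≡ addTo t o (b xor c) ρ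
addTo-xor 0F false b c (p , q , r) = cong (λ z → z , q , r) (xor-merge p q b c)
addTo-xor 0F true  b c (p , q , r) = cong (λ z → z , q , r) (xor-merge p r b c)
addTo-xor 1F false b c (p , q , r) = cong (λ z → p , z , r) (xor-merge q r b c)
addTo-xor 1F true  b c (p , q , r) = cong (λ z → p , z , r) (xor-merge q p b c)
addTo-xor 2F false b c (p , q , r) = cong (λ z → p , q , z) (xor-merge r p b c)
addTo-xor 2F true  b c (p , q , r) = cong (λ z → p , q , z) (xor-merge r q b c)

-- The target evolves as in `xor-commutator`, while the third register gets the same summand twice
-- and is thereby restored.
addTo-∧ : ∀ t o b c ρ →
  addTo t (not o) c (addTo (third t o) (not o) b
    (addTo t (not o) c (addTo (third t o) (not o) b ρ)))
    ≡ addTo t o (b ∧ c) ρ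
addTo-∧ 0F false b c (p , q , r) =
  cong₂ (λ z w → z , q , w) (xor-commutator p q r b c) (xor-restore r (q ∧ b))
addTo-∧ 0F true  b c (p , q , r) =
  cong₂ (λ z w → z , w , r) (xor-commutator p r q b c) (xor-restore q (r ∧ b))
addTo-∧ 1F false b c (p , q , r) =
  cong₂ (λ z w → w , z , r) (xor-commutator q r p b c) (xor-restore p (r ∧ b))
addTo-∧ 1F true  b c (p , q , r) =
  cong₂ (λ z w → p , z , w) (xor-commutator q p r b c) (xor-restore r (p ∧ b))
addTo-∧ 2F false b c (p , q , r) =
  cong₂ (λ z w → p , w , z) (xor-commutator r p q b c) (xor-restore q (p ∧ b))
addTo-∧ 2F true  b c (p , q , r) =
  cong₂ (λ z w → w , q , z) (xor-commutator r q p b c) (xor-restore p (q ∧ b))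

run-++ : ∀ x p q c → run x (p ++ q) c ≡ run x q (run x p c)
run-++ x []      q c = refl
run-++ x (ι ∷ p) q c = run-++ x p q _

run-++≡ : ∀ x p q {c d e} → run x p c ≡ d → run x q d ≡ e → run x (p ++ q) c ≡ e
run-++≡ x p q refl refl = run-++ x p q _

moveRO-R : ∀ {n i} → i < n → moveRO n R i ≡ suc i
moveRO-R {n} {i} i<n with i <? n
... | yes _   = refl
... | no  i≮n = contradiction i<n i≮n

run-▸ : ∀ x k {i ρ} → i + k ≤ length x →
        run x (replicate k ▸) (ρ , i) ≡ (ρ , i + k)
run-▸ x zero    {i}     _ = cong (_ ,_) (sym (+-identityʳ i))
run-▸ x (suc k) {i} {ρ} h rewrite +-suc i k
  | moveRO-R (≤-trans (s≤s (m≤m+n i k)) h) = run-▸ x k h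

run-◂ : ∀ x k {ρ} → run x (replicate k ◂) (ρ , k) ≡ (ρ , 0)
run-◂ x zero    = refl
run-◂ x (suc k) = run-◂ x k

-- Induction on the formula, with head position 0 as the invariant. Indexing by `length x` keeps
-- every addressed cell inside the input, where `moveRO` does not clamp the head.
run-compile : ∀ x (F : Formula (length x)) t o ρ →
              run x (compile F t o) (ρ , 0) ≡ (addTo t o (eval F x) ρ , 0)
run-compile x (const false) t o ρ = cong (_, 0) (sym (addTo-false t o ρ))
run-compile x (const true)  t o ρ = refl
run-compile x (var k)       t o ρ =
  run-++≡ x (replicate (toℕ k) ▸) _
    (run-▸ x (toℕ k) (<⇒≤ (toℕ<n k))) (run-◂ x (toℕ k))
run-compile x (F ⊕ G) t o ρ =
  run-++≡ x (compile F t o) _ (run-compile x F t o ρ)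
    (trans (run-compile x G t o _) (cong (_, 0) (addTo-xor t o (eval F x) _ ρ)))
run-compile x (F ⊗ G) t o ρ =
  run-++≡ x f _ (run-compile x F _ _ _)
    (run-++≡ x g _ (run-compile x G _ _ _)
      (run-++≡ x f _ (run-compile x F _ _ _)
        (trans (run-compile x G _ _ _)
          (cong (_, 0) (addTo-∧ t o (eval F x) (eval G x) ρ)))))
  where
  f = compile F (third t o) (not o)
  g = compile G t (not o)

-- Measures the compiled program rather than the tree: a variable pays for the travel of the head,
-- and a product for two copies of each factor.
size : ∀ {n} → Formula n → ℕ
size (const _) = 1
size (var k)   = toℕ k + suc (toℕ k)
size (F ⊕ G)   = size F + size G
size (F ⊗ G)   = size F + (size G + (size F + size G))

length-++-≤ : ∀ {A : Set} (p q : List A) {a b} →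
              length p ≤ a → length q ≤ b → length (p ++ q) ≤ a + b
length-++-≤ p q p≤a q≤b rewrite length-++ p {q} = +-mono-≤ p≤a q≤b

length-compile : ∀ {n} (F : Formula n) t o → length (compile F t o) ≤ size F
length-compile (const false) t o = z≤n
length-compile (const true)  t o = ≤-refl
length-compile (var k)       t o =
  length-++-≤ (replicate (toℕ k) ▸) _ (≤-reflexive (length-replicate (toℕ k)))
    (s≤s (≤-reflexive (length-replicate (toℕ k))))
length-compile (F ⊕ G) t o =
  length-++-≤ (compile F t o) _ (length-compile F t o) (length-compile G t o)
length-compile (F ⊗ G) t o =
  length-++-≤ f _ (length-compile F _ _)
    (length-++-≤ g _ (length-compile G _ _)
      (length-++-≤ f _ (length-compile F _ _) (length-compile G _ _)))
  where
  f = compile F (third t o) (not o)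
  g = compile G t (not o)

-- Reachability as a formula

-- Disjunction over GF(2), as the polynomial `a + b + ab`.
_⊙_ : ∀ {n} → Formula n → Formula n → Formula n
F ⊙ G = (F ⊕ G) ⊕ (F ⊗ G)

infixl 5 _⊙_

some : ∀ {n} m → (Vec Bool m → Formula n) → Formula n
some zero    F = F []
some (suc m) F = some m (F ∘ (false ∷_)) ⊙ some m (F ∘ (true ∷_))

eval-⊙ : ∀ {n} (F G : Formula n) x → eval (F ⊙ G) x ≡ eval F x ∨ eval G x
eval-⊙ F G x = xor-∨ (eval F x) (eval G x)
  where
  xor-∨ : ∀ a b → (a xor b) xor (a ∧ b) ≡ a ∨ b
  xor-∨ false false = refl
  xor-∨ false true  = refl
  xor-∨ true  false = refl
  xor-∨ true  true  = refl

∨-true⁻ : ∀ a {b} → a ∨ b ≡ true → a ≡ true ⊎ b ≡ true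
∨-true⁻ true  _ = inj₁ refl
∨-true⁻ false h = inj₂ h

∨-trueʳ : ∀ a {b} → b ≡ true → a ∨ b ≡ true
∨-trueʳ true  _ = refl
∨-trueʳ false h = h

∧-true⁻ : ∀ a {b} → a ∧ b ≡ true → a ≡ true × b ≡ true
∧-true⁻ true h = refl , h

eval-some⁻ : ∀ {n} m (F : Vec Bool m → Formula n) x →
             eval (some m F) x ≡ true → ∃[ v ] eval (F v) x ≡ true
eval-some⁻ zero    F x h = [] , h
eval-some⁻ (suc m) F x h
  with ∨-true⁻ (eval (some m (F ∘ (false ∷_))) x)
         (trans (sym (eval-⊙ (some m (F ∘ (false ∷_))) (some m (F ∘ (true ∷_))) x)) h)
... | inj₁ h₀ = let v , p = eval-some⁻ m (F ∘ (false ∷_)) x h₀ in false ∷ v , p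
... | inj₂ h₁ = let v , p = eval-some⁻ m (F ∘ (true ∷_)) x h₁ in true ∷ v , p

eval-some⁺ : ∀ {n} m (F : Vec Bool m → Formula n) x v →
             eval (F v) x ≡ true → eval (some m F) x ≡ true
eval-some⁺ zero    F x []          h = h
eval-some⁺ (suc m) F x (false ∷ v) h =
  trans (eval-⊙ (some m (F ∘ (false ∷_))) (some m (F ∘ (true ∷_))) x)
    (cong (_∨ eval (some m (F ∘ (true ∷_))) x) (eval-some⁺ m (F ∘ (false ∷_)) x v h))
eval-some⁺ (suc m) F x (true ∷ v)  h =
  trans (eval-⊙ (some m (F ∘ (false ∷_))) (some m (F ∘ (true ∷_))) x)
    (∨-trueʳ _ (eval-some⁺ m (F ∘ (true ∷_)) x v h))

size-⊗ : ∀ {n} (F G : Formula n) e →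
         size F ≤ 2 ^ e → size G ≤ 2 ^ e → size (F ⊗ G) ≤ 2 ^ (2 + e)
size-⊗ F G e F≤ G≤ = begin
  size F + (size G + (size F + size G))
    ≤⟨ +-mono-≤ F≤ (+-mono-≤ G≤ (+-mono-≤ F≤ G≤)) ⟩
  2 ^ e + (2 ^ e + (2 ^ e + 2 ^ e))
    ≡⟨ cong (λ z → 2 ^ e + (2 ^ e + (2 ^ e + z))) (sym (+-identityʳ (2 ^ e))) ⟩
  4 * 2 ^ e
    ≡⟨ *-assoc 2 2 (2 ^ e) ⟩
  2 ^ (2 + e) ∎
  where open ≤-Reasoning

size-⊙ : ∀ {n} (F G : Formula n) e →
         size F ≤ 2 ^ e → size G ≤ 2 ^ e → size (F ⊙ G) ≤ 2 ^ (3 + e)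
size-⊙ F G e F≤ G≤ = begin
  (size F + size G) + size (F ⊗ G)
    ≤⟨ +-mono-≤ (+-mono-≤ F≤ G≤) (size-⊗ F G e F≤ G≤) ⟩
  (2 ^ e + 2 ^ e) + 2 ^ (2 + e)
    ≤⟨ +-monoˡ-≤ _ (≤-trans (≤-reflexive (cong (2 ^ e +_) (sym (+-identityʳ _))))
                            (m≤m+n (2 * 2 ^ e) _)) ⟩
  2 ^ (2 + e) + 2 ^ (2 + e)
    ≡⟨ cong (2 ^ (2 + e) +_) (sym (+-identityʳ _)) ⟩
  2 ^ (3 + e) ∎
  where open ≤-Reasoning

-- Each quantified bit costs one `_⊙_`, which holds three copies of each side: six in all, rounded
-- up to a factor of 8.
size-some : ∀ {n} m (F : Vec Bool m → Formula n) e →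
            (∀ v → size (F v) ≤ 2 ^ e) → size (some m F) ≤ 2 ^ (m * 3 + e)
size-some zero    F e F≤ = F≤ []
size-some (suc m) F e F≤ =
  size-⊙ (some m F₀) (some m F₁) (m * 3 + e)
    (size-some m F₀ e (F≤ ∘ (false ∷_))) (size-some m F₁ e (F≤ ∘ (true ∷_)))
  where
  F₀ = F ∘ (false ∷_)
  F₁ = F ∘ (true ∷_)

-- Walks, removal of loops and the pigeonhole bound

module _ {V : Set} (E : V → V → Set) where

  -- The list collects the sources of the steps.
  data Walk : V → List V → V → Set where
    []  : ∀ {u} → Walk u [] u
    _∷_ : ∀ {u w vs v} → E u w → Walk w vs v → Walk u (u ∷ vs) v

  walk⇒star : ∀ {u vs v} → Walk u vs v → Star E u v
  walk⇒star []       = ε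
  walk⇒star (e ∷ es) = e ◅ walk⇒star es

  split : ∀ a b {u vs v} → Walk u vs v → length vs ≤ a + b →
          ∃[ w ] ∃[ us ] ∃[ ws ] Walk u us w × length us ≤ a
                               × Walk w ws v × length ws ≤ b
  split zero    b es       h = _ , [] , _ , [] , z≤n , es , h
  split (suc a) b []       h = _ , [] , [] , [] , z≤n , [] , z≤n
  split (suc a) b (e ∷ es) (s≤s h) =
    let w , us , ws , p , us≤ , q , ws≤ = split a b es h
    in w , _ ∷ us , ws , e ∷ p , s≤s us≤ , q , ws≤

  -- Distinct sources already bound the number of steps by the number of vertices; the endpoint may
  -- recur among them.
  Simple : V → V → Set
  Simple u v = ∃[ vs ] Walk u vs v × Unique vs

  -- Restarting at the occurrence of `u` cuts out a loop, and a suffix of a duplicate-free list is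
  -- duplicate-free.
  shortcut : ∀ {u w vs v} → u ∈ vs → Walk w vs v → Unique vs → Simple u v
  shortcut (here refl) (e ∷ es) us       = _ , e ∷ es , us
  shortcut (there u∈)  (e ∷ es) (_ ∷ us) = shortcut u∈ es us

  simplify : DecidableEquality V → ∀ {u v} → Star E u v → Simple u v
  simplify _≟_ ε = [] , [] , []
  simplify _≟_ {u} (e ◅ es) with simplify _≟_ es
  ... | vs , p , uniq with DecMembership._∈?_ _≟_ u vs
  ...   | yes u∈ = shortcut u∈ p uniq
  ...   | no  u∉ = u ∷ vs , e ∷ p , ¬Any⇒All¬ vs u∉ ∷ uniq

lookup-injective : ∀ {A : Set} {xs : List A} → Unique xs →
                   Injective _≡_ _≡_ (lookup xs)
lookup-injective {xs = _ ∷ _} _        {zero}  {zero}  _  = refl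
lookup-injective {xs = _ ∷ _} (x∉ ∷ _) {zero}  {suc j} eq =
  contradiction (subst (_∈ _) (sym eq) (∈-lookup j)) (All¬⇒¬Any x∉)
lookup-injective {xs = _ ∷ _} (x∉ ∷ _) {suc i} {zero}  eq =
  contradiction (subst (_∈ _) eq (∈-lookup i)) (All¬⇒¬Any x∉)
lookup-injective {xs = _ ∷ _} (_ ∷ us) {suc i} {suc j} eq =
  cong suc (lookup-injective us eq)

index : ∀ {m} → Vec Bool m → Fin (2 ^ m)
index []      = zero
index (b ∷ v) = combine {2} (if b then suc zero else zero) (index v)

index-injective : ∀ {m} → Injective _≡_ _≡_ (index {m})
index-injective {x = []}    {[]}    _  = refl
index-injective {x = b ∷ u} {c ∷ v} eq
  with combine-injective _ (index u) _ (index v) eq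
... | b≡c , u≡v = cong₂ _∷_ (bit b c b≡c) (index-injective u≡v)
  where
  bit : ∀ b c → _≡_ {A = Fin 2} (if b then suc zero else zero)
                                (if c then suc zero else zero) → b ≡ c
  bit false false _ = refl
  bit true  true  _ = refl

-- Pigeonhole: list positions inject into `Fin (2 ^ m)` through the binary value of the entry.
length-unique : ∀ {m} {vs : List (Vec Bool m)} → Unique vs → length vs ≤ 2 ^ m
length-unique us = injective⇒≤ (lookup-injective us ∘ index-injective)

_≟ᵛ_ : ∀ {m} → DecidableEquality (Vec Bool m)
_≟ᵛ_ = ≡-dec _≟ᵇ_

-- Savitch's midpoint recursion

module Savitch {n m} (edge : Vec Bool m → Vec Bool m → Formula n) where

  -- Reachability in at most `2 ^ k` steps, with `w` as midpoint. Equality in the base case admits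
  -- the empty walk, so the bound is "at most" and not "exactly".
  within : ℕ → Vec Bool m → Vec Bool m → Formula n
  within zero    u v = if ⌊ u ≟ᵛ v ⌋ then const true else edge u v
  within (suc k) u v = some m (λ w → within k u w ⊗ within k w v)

  Edge : List Bool → Vec Bool m → Vec Bool m → Set
  Edge x u v = eval (edge u v) x ≡ true

  within-sound : ∀ x k u v → eval (within k u v) x ≡ true → Star (Edge x) u v
  within-sound x zero u v h with u ≟ᵛ v
  ... | yes refl = ε
  ... | no  _    = h ◅ ε
  within-sound x (suc k) u v h =
    let w , uwv = eval-some⁻ m (λ w → within k u w ⊗ within k w v) x h
        uw , wv = ∧-true⁻ (eval (within k u w) x) uwv
    in within-sound x k u w uw ◅◅ within-sound x k w v wv

  within-complete : ∀ x k {u vs v} → Walk (Edge x) u vs v → length vs ≤ 2 ^ k →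
                    eval (within k u v) x ≡ true
  within-complete x zero {u} {v = v} p h with u ≟ᵛ v
  within-complete x zero p        h | yes _   = refl
  within-complete x zero []       h | no  u≢u = contradiction refl u≢u
  within-complete x zero (e ∷ []) h | no  _   = e
  within-complete x zero (_ ∷ _ ∷ _) (s≤s ()) | no _
  within-complete x (suc k) {u} {v = v} p h =
    let w , us , ws , uw , us≤ , wv , ws≤ =
          split (Edge x) (2 ^ k) (2 ^ k) p
            (≤-trans h (≤-reflexive (cong (2 ^ k +_) (+-identityʳ (2 ^ k)))))
    in eval-some⁺ m (λ w → within k u w ⊗ within k w v) x w
         (cong₂ _∧_ (within-complete x k uw us≤) (within-complete x k wv ws≤))

  -- Depth `m` suffices, because a walk with distinct sources has at most `2 ^ m` steps.
  connected : Vec Bool m → Vec Bool m → Formula n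
  connected = within m

  connected-sound : ∀ x {u v} → eval (connected u v) x ≡ true → Star (Edge x) u v
  connected-sound x = within-sound x m _ _

  connected-complete : ∀ x {u v} → Star (Edge x) u v → eval (connected u v) x ≡ true
  connected-complete x es =
    let vs , p , us = simplify (Edge x) _≟ᵛ_ es
    in within-complete x m p (length-unique us)

  -- Each level adds `m * 3` to the exponent for the choice of midpoint and 2 for the product; `m`
  -- levels give an exponent quadratic in `m`.
  size-within : ∀ e → (∀ u v → size (edge u v) ≤ 2 ^ e) →
                ∀ k u v → size (within k u v) ≤ 2 ^ (k * (m * 3 + 2) + e)
  size-within e edge≤ zero u v with ⌊ u ≟ᵛ v ⌋
  ... | true  = m^n>0 2 e
  ... | false = edge≤ u v
  size-within e edge≤ (suc k) u v = begin
    size (some m (λ w → within k u w ⊗ within k w v))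
      ≤⟨ size-some m (λ w → within k u w ⊗ within k w v) (2 + d)
           (λ w → size-⊗ (within k u w) (within k w v) d
                    (size-within e edge≤ k u w) (size-within e edge≤ k w v)) ⟩
    2 ^ (m * 3 + (2 + d))
      ≡⟨ cong (2 ^_) (trans (sym (+-assoc (m * 3) 2 _))
                            (sym (+-assoc (m * 3 + 2) (k * (m * 3 + 2)) e))) ⟩
    2 ^ (suc k * (m * 3 + 2) + e) ∎
    where
    open ≤-Reasoning
    d = k * (m * 3 + 2) + e

-- Configuration graphs

toBits : ∀ k → ℕ → Vec Bool k
toBits zero    i = []
toBits (suc k) i = (i % 2 ≡ᵇ 1) ∷ toBits k (i / 2)

fromBits : ∀ {k} → Vec Bool k → ℕ
fromBits []      = 0
fromBits (b ∷ v) = (if b then 1 else 0) + fromBits v * 2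

fromBits-toBits : ∀ k {i} → i < 2 ^ k → fromBits (toBits k i) ≡ i
fromBits-toBits zero    (s≤s z≤n) = refl
fromBits-toBits (suc k) {i} i< = trans
  (cong₂ (λ r q → r + q * 2) (bit (i % 2) (m%n<n i 2))
    (fromBits-toBits k (m<n*o⇒m/o<n (subst (i <_) (*-comm 2 (2 ^ k)) i<))))
  (sym (m≡m%n+[m/n]*n i 2))
  where
  bit : ∀ r → r < 2 → (if r ≡ᵇ 1 then 1 else 0) ≡ r
  bit 0 _ = refl
  bit 1 _ = refl
  bit (suc (suc _)) (s≤s (s≤s ()))

cells : ∀ k → (ℕ → Bool) → Vec Bool k
cells zero    t = []
cells (suc k) t = t 0 ∷ cells k (t ∘ suc)

fromCells : ∀ {k} → Vec Bool k → ℕ → Bool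
fromCells []      _       = false
fromCells (b ∷ v) zero    = b
fromCells (b ∷ v) (suc j) = fromCells v j

fromCells-cells : ∀ k t {j} → j < k → fromCells (cells k t) j ≡ t j
fromCells-cells (suc k) t {zero}  _         = refl
fromCells-cells (suc k) t {suc j} (s≤s j<k) = fromCells-cells k (t ∘ suc) j<k

cells-cong : ∀ k {t t′} → (∀ j → j < k → t j ≡ t′ j) → cells k t ≡ cells k t′
cells-cong zero    eq = refl
cells-cong (suc k) eq =
  cong₂ _∷_ (eq 0 z<s) (cells-cong k λ j j<k → eq (suc j) (s<s j<k))

write-cong : ∀ {t t′} w b j → t j ≡ t′ j → write t w b j ≡ write t′ w b j
write-cong w b j eq with j ≟ w
... | yes _ = refl
... | no  _ = eq

take-++ : ∀ {A : Set} {m n} (u : Vec A m) (v : Vec A n) → takeᵛ m (u ⧺ v) ≡ u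
take-++ []      v = refl
take-++ (x ∷ u) v = cong (x ∷_) (take-++ u v)

drop-++ : ∀ {A : Set} {m n} (u : Vec A m) (v : Vec A n) → dropᵛ m (u ⧺ v) ≡ v
drop-++ []      v = refl
drop-++ (x ∷ u) v = drop-++ u v

moveRO-≤ : ∀ {b i} m → i ≤ b → moveRO b m i ≤ b
moveRO-≤ {i = zero}  L _ = z≤n
moveRO-≤ {i = suc i} L h = ≤-trans (n≤1+n i) h
moveRO-≤             S h = h
moveRO-≤ {b} {i}     R h with i <? b
... | yes i<b = i<b
... | no  _   = h

readRO-< : ∀ x {i} → i < length x → ∃[ b ] readRO x i ≡ just b
readRO-< (b ∷ x) {zero}  _       = b , refl
readRO-< (b ∷ x) {suc i} (s≤s h) = readRO-< x h

readRO-≥ : ∀ x {i} → length x ≤ i → readRO x i ≡ nothing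
readRO-≥ []      _             = refl
readRO-≥ (b ∷ x) {suc i} (s≤s h) = readRO-≥ x h

-- Interpolation over GF(2): a function of one bit is `f(0) + (f(0) + f(1))x`. Beyond the input the
-- symbol is known, and the formula is constant.
atCell : ∀ {n} → ℕ → (Maybe Bool → Bool) → Formula n
atCell {n} i f with i <? n
... | yes i<n = const (f (just false)) ⊕
                const (f (just false) xor f (just true)) ⊗ var (fromℕ< i<n)
... | no  _   = const (f nothing)

eval-atCell : ∀ x i f → eval {length x} (atCell i f) x ≡ f (readRO x i)
eval-atCell x i f with i <? length x
... | no  i≮n = cong f (sym (readRO-≥ x (≮⇒≥ i≮n)))
... | yes i<n rewrite toℕ-fromℕ< i<n with readRO-< x i<n
...   | b , eq rewrite eq = select b
  where
  cancel : ∀ p q → p xor ((p xor q) ∧ true) ≡ q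
  cancel false false = refl
  cancel false true  = refl
  cancel true  false = refl
  cancel true  true  = refl

  select : ∀ b → f (just false) xor ((f (just false) xor f (just true)) ∧ b)
               ≡ f (just b)
  select false = trans (cong (f (just false) xor_) (∧-zeroʳ _)) (xor-identityʳ _)
  select true  = cancel (f (just false)) (f (just true))

size-atCell : ∀ {n} W i f → n < 2 ^ W → size (atCell {n} i f) ≤ 2 ^ (3 + W)
size-atCell {n} W i f n< with i <? n
... | no  _   = m^n>0 2 (3 + W)
... | yes i<n rewrite toℕ-fromℕ< i<n = begin
  2 + (i + suc i + (1 + (i + suc i)))
    ≤⟨ +-mono-≤ 2≤ (+-mono-≤ i+1+i≤ (+-mono-≤ (m^n>0 2 W) i+1+i≤)) ⟩
  (B + B) + ((B + B) + (B + (B + B)))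
    ≤⟨ m≤m+n _ B ⟩
  (B + B) + ((B + B) + (B + (B + B))) + B
    ≡⟨ solve 1 (λ b → b :+ b :+ (b :+ b :+ (b :+ (b :+ b))) :+ b
                    := con 2 :* (con 2 :* (con 2 :* b))) refl B ⟩
  2 ^ (3 + W) ∎
  where
  open ≤-Reasoning
  open +-*-Solver using (solve; _:+_; _:*_; _:=_; con)
  B = 2 ^ W
  2≤ : 2 ≤ B + B
  2≤ = +-mono-≤ (m^n>0 2 W) (m^n>0 2 W)
  i+1+i≤ : i + suc i ≤ B + B
  i+1+i≤ = +-mono-≤ (<⇒≤ (<-trans i<n n<)) (<-trans i<n n<)

module ConfigurationGraph (M : TM) (a : List Bool) (W n : ℕ) where

  m : ℕ
  m = W + (W + (W + (W + W)))

  -- One width `W` serves all five fields. Only the first `W` tape cells are kept, so decoding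
  -- recovers a configuration up to `_≈_`.
  encode : Config M → Vec Bool m
  encode (cfg q i h w t) =
    toBits W (toℕ q) ⧺ toBits W i ⧺ toBits W h ⧺ toBits W w ⧺ cells W t

  toState : ℕ → Fin (Q M)
  toState k with k <? Q M
  ... | yes k<Q = fromℕ< k<Q
  -- An arbitrary value for codes of no state: only walks from the code of the initial configuration
  -- matter, and these meet codes of reachable configurations only.
  ... | no  _   = start M

  decode : Vec Bool m → Config M
  decode v₀ =
    let v₁ = dropᵛ W v₀
        v₂ = dropᵛ W v₁
        v₃ = dropᵛ W v₂
    in cfg (toState (fromBits (takeᵛ W v₀))) (fromBits (takeᵛ W v₁))
           (fromBits (takeᵛ W v₂)) (fromBits (takeᵛ W v₃))
           (fromCells (dropᵛ W v₃))

  perform : Config M → Fin (Q M) × Bool × Move × Move × Move → Config M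
  perform (cfg q i h w t) (q′ , b , mi , ma , mw) =
    cfg q′ (moveRO n mi i) (moveRO (length a) ma h) (moveW mw w) (write t w b)

  -- The advice is fixed and is read here; the input symbol stays a parameter, so that an edge
  -- depends on a single input bit and fits `atCell`.
  successors : Maybe Bool → Config M → List (Config M)
  successors s C =
    map (perform C) (δ M (state C) s (readRO a (ahead C)) (tape C (whead C)))

  open DecMembership (_≟ᵛ_ {m}) using (_∈?_)

  edge : Vec Bool m → Vec Bool m → Formula n
  edge u v = atCell (ihead (decode u))
    λ s → ⌊ v ∈? map encode (successors s (decode u)) ⌋

  open Savitch edge public

  accepted : Formula n
  accepted = some m λ v →
    if accepting M (state (decode v)) then connected (encode (initial M)) v
                                      else const false

  size-accepted : n < 2 ^ W →
                  size accepted ≤ 2 ^ (m * 3 + (m * (m * 3 + 2) + (3 + W)))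
  size-accepted n< = size-some m _ _ bound
    where
    bound : ∀ v → size (if accepting M (state (decode v))
                        then connected (encode (initial M)) v else const false)
                ≤ 2 ^ (m * (m * 3 + 2) + (3 + W))
    bound v with accepting M (state (decode v))
    ... | true  = size-within (3 + W) (λ u v → size-atCell W (ihead (decode u)) _ n<) m _ v
    ... | false = m^n>0 2 (m * (m * 3 + 2) + (3 + W))

  toState-toℕ : ∀ q → toState (toℕ q) ≡ q
  toState-toℕ q with toℕ q <? Q M
  ... | yes q<Q = fromℕ<-toℕ q q<Q
  ... | no  q≮Q = contradiction (toℕ<n q) q≮Q

  -- Tapes are functions on all of `ℕ`, of which the encoding sees only a window of `W` cells.
  data _≈_ : Config M → Config M → Set where
    cfg : ∀ {q i h w t t′} → (∀ j → j < W → t j ≡ t′ j) →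
          cfg q i h w t ≈ cfg q i h w t′

  encode-cong : ∀ {C D} → C ≈ D → encode C ≡ encode D
  encode-cong (cfg {q} {i} {h} {w} t≈t′) =
    cong (λ u → toBits W (toℕ q) ⧺ toBits W i ⧺ toBits W h ⧺ toBits W w ⧺ u)
      (cells-cong W t≈t′)

  perform-cong : ∀ {C D} → C ≈ D → ∀ τ → perform C τ ≈ perform D τ
  perform-cong (cfg {w = w} t≈t′) (_ , b , _) =
    cfg λ j j<W → write-cong w b j (t≈t′ j j<W)

  -- With the work head inside the window both configurations scan the same symbol, hence have the
  -- same transitions.
  encode-successors : ∀ {C D} s → C ≈ D → whead D < W →
    map encode (successors s C) ≡ map encode (successors s D)
  encode-successors {C} {D} s C≈D@(cfg {q} {h = h} {w} {t′ = t′} t≈t′) w<W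
    rewrite t≈t′ w w<W =
    trans (sym (map-∘ τs))
      (trans (map-cong (encode-cong ∘ perform-cong C≈D) τs) (map-∘ τs))
    where τs = δ M q s (readRO a h) (t′ w)

  decode-encode : ∀ {C} → Q M ≤ 2 ^ W → ihead C < 2 ^ W → ahead C < 2 ^ W →
                  whead C < 2 ^ W → decode (encode C) ≈ C
  decode-encode {cfg q i h w t} Q≤ i< h< w<
    rewrite take-++ (toBits W (toℕ q)) (toBits W i ⧺ toBits W h ⧺ toBits W w ⧺ cells W t)
          | drop-++ (toBits W (toℕ q)) (toBits W i ⧺ toBits W h ⧺ toBits W w ⧺ cells W t)
          | take-++ (toBits W i) (toBits W h ⧺ toBits W w ⧺ cells W t)
          | drop-++ (toBits W i) (toBits W h ⧺ toBits W w ⧺ cells W t)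
          | take-++ (toBits W h) (toBits W w ⧺ cells W t)
          | drop-++ (toBits W h) (toBits W w ⧺ cells W t)
          | take-++ (toBits W w) (cells W t)
          | drop-++ (toBits W w) (cells W t)
          | fromBits-toBits W (≤-trans (toℕ<n q) Q≤)
          | fromBits-toBits W i<
          | fromBits-toBits W h<
          | fromBits-toBits W w<
          | toState-toℕ q
    = cfg λ j → fromCells-cells W t

⌊⌋-true⁻ : ∀ {P : Set} (d : Dec P) → ⌊ d ⌋ ≡ true → P
⌊⌋-true⁻ (yes p) _ = p

⌊⌋-true⁺ : ∀ {P : Set} (d : Dec P) → P → ⌊ d ⌋ ≡ true
⌊⌋-true⁺ (yes _) _ = refl
⌊⌋-true⁺ (no ¬p) p = contradiction p ¬p

n<2^n : ∀ n → n < 2 ^ n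
n<2^n zero    = ≤-refl
n<2^n (suc n) = +-mono-≤ (m^n>0 2 n) (≤-trans (n<2^n n) (m≤m+n _ 0))

-- Walks on codes correspond to computations

module _ (M : TM) (x a : List Bool) (W : ℕ)
  (Q≤ : Q M ≤ 2 ^ W) (x< : length x < 2 ^ W) (a< : length a < 2 ^ W)
  (space : ∀ C → Reachable M x a C → whead C < W) where

  open ConfigurationGraph M a W (length x)
  open DecMembership (_≟ᵛ_ {m}) using (_∈?_)

  heads-≤ : ∀ {C D} → Star (Step M x a) C D →
            ihead C ≤ length x × ahead C ≤ length a →
            ihead D ≤ length x × ahead D ≤ length a
  heads-≤ ε h = h
  heads-≤ (step {mi = mi} {ma} _ ◅ ss) (i≤ , h≤) =
    heads-≤ ss (moveRO-≤ mi i≤ , moveRO-≤ ma h≤)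

  decode-reachable : ∀ {C} → Reachable M x a C → decode (encode C) ≈ C
  decode-reachable {C} r =
    let i≤ , h≤ = heads-≤ r (z≤n , z≤n)
    in decode-encode Q≤ (≤-<-trans i≤ x<) (≤-<-trans h≤ a<)
         (<-trans (space C r) (n<2^n W))

  ≈⇒state : ∀ {C D} → C ≈ D → state C ≡ state D
  ≈⇒state (cfg _) = refl

  ≈⇒ihead : ∀ {C D} → C ≈ D → ihead C ≡ ihead D
  ≈⇒ihead (cfg _) = refl

  eval-edge : ∀ {C} v → Reachable M x a C →
    eval (edge (encode C) v) x
      ≡ ⌊ v ∈? map encode (successors (readRO x (ihead C)) C) ⌋
  eval-edge {C} v r =
    trans (eval-atCell x (ihead (decode (encode C))) _)
      (cong (λ us → ⌊ v ∈? us ⌋)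
        (trans (encode-successors _ C≈ (space C r))
               (cong (λ i → map encode (successors (readRO x i) C)) (≈⇒ihead C≈))))
    where C≈ = decode-reachable r

  step⇒edge : ∀ {C D} → Reachable M x a C → Step M x a C D →
              Edge x (encode C) (encode D)
  step⇒edge {C} r (step τ∈) =
    trans (eval-edge _ r) (⌊⌋-true⁺ (_ ∈? _) (∈-map⁺ encode (∈-map⁺ (perform C) τ∈)))

  -- Vectors that encode nothing are never entered: an edge leaving the code of a reachable
  -- configuration ends at the code of a successor.
  edge⇒step : ∀ {C v} → Reachable M x a C → Edge x (encode C) v →
              ∃[ D ] Step M x a C D × v ≡ encode D
  edge⇒step {C@(cfg _ _ _ _ _)} {v} r e
    with ∈-map⁻ encode (⌊⌋-true⁻ (v ∈? _) (trans (sym (eval-edge _ r)) e))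
  ... | D , D∈ , v≡ with ∈-map⁻ (perform C) D∈
  ...   | _ , τ∈ , refl = _ , step τ∈ , v≡

  steps⇒edges : ∀ {C D} → Reachable M x a C → Star (Step M x a) C D →
                Star (Edge x) (encode C) (encode D)
  steps⇒edges r ε        = ε
  steps⇒edges r (s ◅ ss) = step⇒edge r s ◅ steps⇒edges (r ◅◅ s ◅ ε) ss

  edges⇒steps : ∀ {C v} → Reachable M x a C → Star (Edge x) (encode C) v →
                ∃[ D ] Reachable M x a D × v ≡ encode D
  edges⇒steps r ε        = _ , r , refl
  edges⇒steps r (e ◅ es) with edge⇒step r e
  ... | D , s , refl = edges⇒steps (r ◅◅ s ◅ ε) es

  accepted-sound : eval accepted x ≡ true → Accepts M x a
  accepted-sound h with eval-some⁻ m _ x h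
  ... | v , p with accepting M (state (decode v)) in acc
  ...   | true with edges⇒steps ε (connected-sound x p)
  ...     | D , r , refl =
    D , r , trans (cong (accepting M) (sym (≈⇒state (decode-reachable r)))) acc

  accepted-complete : Accepts M x a → eval accepted x ≡ true
  accepted-complete (C , r , acc) = eval-some⁺ m _ x (encode C)
    (subst (λ b → eval (if b then connected (encode (initial M)) (encode C)
                             else const false) x ≡ true)
      (sym (trans (cong (accepting M) (≈⇒state (decode-reachable r))) acc))
      (connected-complete x (steps⇒edges ε r)))

-- A program interpreter with a fixed finite control

-- The first two bits name the target, with 11 reserved for head moves; the third is the orientation
-- or direction, and the fourth marks use of the scanned input bit.
opcode : Instr → Bool × Bool × Bool × Bool
opcode (add 0F o)    = false , false , o , false
opcode (add 1F o)    = false , true  , o , false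
opcode (add 2F o)    = true  , false , o , false
opcode (addBit 0F o) = false , false , o , true
opcode (addBit 1F o) = false , true  , o , true
opcode (addBit 2F o) = true  , false , o , true
opcode ◂             = true  , true  , false , false
opcode ▸             = true  , true  , true  , false

instr : Bool × Bool × Bool × Bool → Instr
instr (false , false , o , false) = add 0F o
instr (false , true  , o , false) = add 1F o
instr (true  , false , o , false) = add 2F o
instr (false , false , o , true)  = addBit 0F o
instr (false , true  , o , true)  = addBit 1F o
instr (true  , false , o , true)  = addBit 2F o
instr (true  , true  , false , _) = ◂
instr (true  , true  , true  , _) = ▸

instr-opcode : ∀ ι → instr (opcode ι) ≡ ι
instr-opcode (add 0F o)    = refl
instr-opcode (add 1F o)    = refl
instr-opcode (add 2F o)    = refl
instr-opcode (addBit 0F o) = refl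
instr-opcode (addBit 1F o) = refl
instr-opcode (addBit 2F o) = refl
instr-opcode ◂             = refl
instr-opcode ▸             = refl

assemble : List Instr → List Bool
assemble []      = []
assemble (ι ∷ p) =
  let b₀ , b₁ , b₂ , b₃ = opcode ι in b₀ ∷ b₁ ∷ b₂ ∷ b₃ ∷ assemble p

length-assemble : ∀ p → length (assemble p) ≡ length p * 4
length-assemble []      = refl
length-assemble (ι ∷ p) = cong (4 +_) (length-assemble p)

-- A sum of products, so that finiteness follows by composing bijections. The running states hold
-- the registers and the opcode bits read so far, at most three.
State : Set
State = (⊤ ⊎ Bool) ⊎ Bool ⊎
        (Registers × (⊤ ⊎ Bool ⊎ (Bool × Bool) ⊎ (Bool × Bool × Bool)))

pattern starting     = inj₁ (inj₁ tt)
pattern probed b     = inj₁ (inj₂ b)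
pattern halt b       = inj₂ (inj₁ b)
pattern run₀ ρ       = inj₂ (inj₂ (ρ , inj₁ tt))
pattern run₁ ρ b     = inj₂ (inj₂ (ρ , inj₂ (inj₁ b)))
pattern run₂ ρ b c   = inj₂ (inj₂ (ρ , inj₂ (inj₂ (inj₁ (b , c)))))
pattern run₃ ρ b c d = inj₂ (inj₂ (ρ , inj₂ (inj₂ (inj₂ (b , c , d)))))

_⊎ᶠ_ : ∀ {m n} {A B : Set} → Fin m ↔ A → Fin n ↔ B → Fin (m + n) ↔ (A ⊎ B)
f ⊎ᶠ g = ↔-trans +↔⊎ (f ⊎-↔ g)

_×ᶠ_ : ∀ {m n} {A B : Set} → Fin m ↔ A → Fin n ↔ B → Fin (m * n) ↔ (A × B)
f ×ᶠ g = ↔-trans *↔× (f ×-↔ g)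

infixr 5 _⊎ᶠ_
infixr 6 _×ᶠ_

State-finite : ∃[ k ] (Fin k ↔ State)
State-finite = _ , (1↔⊤ ⊎ᶠ 2↔Bool) ⊎ᶠ 2↔Bool ⊎ᶠ
  ((2↔Bool ×ᶠ 2↔Bool ×ᶠ 2↔Bool) ×ᶠ
   (1↔⊤ ⊎ᶠ 2↔Bool ⊎ᶠ (2↔Bool ×ᶠ 2↔Bool) ⊎ᶠ (2↔Bool ×ᶠ 2↔Bool ×ᶠ 2↔Bool)))

readRO-drop : ∀ a h {b bs} → drop h a ≡ b ∷ bs → readRO a h ≡ just b
readRO-drop (_ ∷ a) zero    refl = refl
readRO-drop (_ ∷ a) (suc h) eq   = readRO-drop a h eq

readRO-drop-[] : ∀ a h → drop h a ≡ [] → readRO a h ≡ nothing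
readRO-drop-[] []      h       _  = refl
readRO-drop-[] (_ ∷ a) (suc h) eq = readRO-drop-[] a h eq

drop-< : ∀ (a : List Bool) h {b bs} → drop h a ≡ b ∷ bs → h < length a
drop-< (_ ∷ a) zero    _  = z<s
drop-< (_ ∷ a) (suc h) eq = s<s (drop-< a h eq)

drop-suc : ∀ (a : List Bool) h {b bs} → drop h a ≡ b ∷ bs → drop (suc h) a ≡ bs
drop-suc (_ ∷ a) zero    refl = refl
drop-suc (_ ∷ a) (suc h) eq   = drop-suc a h eq

module _ {A : Set} {R : A → A → Set} (deterministic : ∀ {s c d} → R s c → R s d → c ≡ d) where

  -- Lets a single halting run decide acceptance: no other halted configuration is reachable.
  normal-form-unique : ∀ {s c d} → Star R s c → Star R s d →
    (∀ e → ¬ R c e) → (∀ e → ¬ R d e) → c ≡ d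
  normal-form-unique ε        ε        _  _  = refl
  normal-form-unique ε        (r ◅ _)  c↛ _  = contradiction r (c↛ _)
  normal-form-unique (r ◅ _)  ε        _  d↛ = contradiction r (d↛ _)
  normal-form-unique (r ◅ rs) (q ◅ qs) c↛ d↛ with refl ← deterministic r q =
    normal-form-unique rs qs c↛ d↛

∈-unique : ∀ {A : Set} {xs : List A} → length xs ≤ 1 →
           ∀ {y z} → y ∈ xs → z ∈ xs → y ≡ z
∈-unique {xs = _ ∷ []}    _         (here refl) (here refl) = refl
∈-unique {xs = _ ∷ _ ∷ _} (s≤s ())

step-deterministic : ∀ M → Deterministic M → ∀ {x a C D E} →
                     Step M x a C D → Step M x a C E → D ≡ E
step-deterministic M det (step τ∈) (step υ∈)
  with refl ← ∈-unique (det _ _ _ _) τ∈ υ∈ = refl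

module Interpreter {k} (states : Fin k ↔ State) (answer : Maybe Bool → Bool) where

  open Inverse states using (to; from; strictlyInverseˡ)

  next : State → Maybe Bool → Maybe Bool → Maybe (State × Move × Move)
  -- The first two input cells are probed to separate lengths 0 and 1, answered from the control,
  -- from longer inputs.
  next starting          nothing  _        = just (halt (answer nothing) , S , S)
  next starting          (just b) _        = just (probed b , R , S)
  next (probed b)        nothing  _        = just (halt (answer (just b)) , S , S)
  -- The head returns to cell 0. With target 0 and source 1 as registers, adding `1 · F` to 0 leaves
  -- the value of `F` in the target.
  next (probed _)        (just _) _        = just (run₀ (false , true , false) , L , S)
  next (halt _)          _        _        = nothing
  next (inj₂ (inj₂ (ρ , _))) _    nothing  = just (halt (proj₁ ρ) , S , S)
  next (run₀ ρ)          _        (just b) = just (run₁ ρ b , S , R)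
  next (run₁ ρ b)        _        (just c) = just (run₂ ρ b c , S , R)
  next (run₂ ρ b c)      _        (just d) = just (run₃ ρ b c d , S , R)
  next (run₃ ρ b c d)    s        (just e) =
    let ι = instr (b , c , d , e) in just (run₀ (update ι s ρ) , shift ι , R)

  Transition : Set
  Transition = Fin k × Bool × Move × Move × Move

  transitions : Maybe (State × Move × Move) → List Transition
  transitions nothing              = []
  transitions (just (σ , mi , ma)) = (from σ , false , mi , ma , S) ∷ []

  acceptingState : State → Bool
  acceptingState (halt b) = b
  acceptingState _        = false

  machine : TM
  machine = record
    { Q         = k
    ; start     = from starting
    ; accepting = acceptingState ∘ to
    ; δ         = λ q s b _ → transitions (next (to q) s b)
    }

  machine-deterministic : Deterministic machine
  machine-deterministic q s b _ with next (to q) s b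
  ... | nothing = z≤n
  ... | just _  = ≤-refl

  module _ (x a : List Bool) where

    whead≡0 : ∀ {C D} → Star (Step machine x a) C D → whead C ≡ 0 → whead D ≡ 0
    whead≡0 ε h = h
    whead≡0 (step {q} {i} {h} τ∈ ◅ ss) refl
      with just _ ← next (to q) (readRO x i) (readRO a h) | here refl ← τ∈ =
      whead≡0 ss refl

    Snapshot : Set
    Snapshot = State × ℕ × ℕ

    -- The machine without its work tape, whose head stays at cell 0 and whose contents no
    -- transition consults; `realise` puts the tape back.
    data _⟶_ : Snapshot → Snapshot → Set where
      fire : ∀ {σ i h σ′ mi ma} →
             next σ (readRO x i) (readRO a h) ≡ just (σ′ , mi , ma) →
             (σ , i , h) ⟶ (σ′ , moveRO (length x) mi i , moveRO (length a) ma h)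

    config : Snapshot → (ℕ → Bool) → Config machine
    config (σ , i , h) t = cfg (from σ) i h 0 t

    realise : ∀ {P P′} → Star _⟶_ P P′ → ∀ t →
              ∃[ t′ ] Star (Step machine x a) (config P t) (config P′ t′)
    realise ε t = t , ε
    realise (_◅_ {σ , i , h} (fire {σ′ = σ′} {mi} {ma} eq) ss) t =
      let t′ , ss′ = realise ss (write t 0 false) in t′ , step τ∈ ◅ ss′
      where
      τ∈ : (from σ′ , false , mi , ma , S) ∈
           transitions (next (to (from σ)) (readRO x i) (readRO a h))
      τ∈ rewrite strictlyInverseˡ σ | eq = here refl

    halted : ∀ {C b} → to (state C) ≡ halt b → ∀ D → ¬ Step machine x a C D
    halted eq D (step τ∈) rewrite eq with () ← τ∈

    acceptingState⁻ : ∀ σ → acceptingState σ ≡ true → σ ≡ halt true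
    acceptingState⁻ (halt true) refl = refl

    -- An accepting configuration is itself halted, so by determinism it is the end of the given
    -- run.
    accepts⇔ : ∀ {b i h} → Star _⟶_ (starting , 0 , 0) (halt b , i , h) →
               b ≡ true ⇔ Accepts machine x a
    accepts⇔ {b} {i} {h} ss = mk⇔ sound complete
      where
      t = proj₁ (realise ss (λ _ → false))
      final = config (halt b , i , h) t

      reached : Reachable machine x a final
      reached = proj₂ (realise ss (λ _ → false))

      final-halt : to (state final) ≡ halt b
      final-halt = strictlyInverseˡ (halt b)

      sound : b ≡ true → Accepts machine x a
      sound b≡ = final , reached , trans (cong acceptingState final-halt) b≡

      complete : Accepts machine x a → b ≡ true
      complete (C , r , acc)
        with refl ← normal-form-unique
                      (step-deterministic machine machine-deterministic) r reached
                      (halted (acceptingState⁻ _ acc)) (halted final-halt) =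
        trans (cong acceptingState (sym final-halt)) acc

    fetch : ∀ {σ i h b bs σ′ mi} → drop h a ≡ b ∷ bs →
            next σ (readRO x i) (just b) ≡ just (σ′ , mi , R) →
            (σ , i , h) ⟶ (σ′ , moveRO (length x) mi i , suc h)
    fetch {σ} {i} {h} {σ′ = σ′} {mi} tail eq =
      subst (λ h′ → (σ , i , h) ⟶ (σ′ , moveRO (length x) mi i , h′))
        (moveRO-R (drop-< a h tail))
        (fire (trans (cong (next σ (readRO x i)) (readRO-drop a h tail)) eq))

    -- The invariant is that the unread advice encodes the rest of the program; each instruction
    -- takes four fetches, the last of which executes it.
    interpret : ∀ p {ρ i h} → drop h a ≡ assemble p →
      let ρ′ , i′ = run x p (ρ , i)
      in ∃[ h′ ] Star _⟶_ (run₀ ρ , i , h) (halt (proj₁ ρ′) , i′ , h′)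
    interpret [] {h = h} tail =
      h , fire (cong (next _ _) (readRO-drop-[] a h tail)) ◅ ε
    interpret (ι ∷ p) {ρ} {i} {h} tail =
      let h′ , ss = interpret p tail₄ in
      h′ , fetch tail refl ◅ fetch tail₁ refl ◅ fetch tail₂ refl ◅
           fetch tail₃ (cong execute (instr-opcode ι)) ◅ ss
      where
      execute = λ ι → just (run₀ (update ι (readRO x i) ρ) , shift ι , R)
      tail₁ = drop-suc a h tail
      tail₂ = drop-suc a (1 + h) tail₁
      tail₃ = drop-suc a (2 + h) tail₂
      tail₄ = drop-suc a (3 + h) tail₃

module _ (Φ : ∀ n → Formula n) where

  program : ℕ → List Instr
  program n = compile (Φ n) 0F false

  -- The quasi-polynomial bound allows only two bits of advice for n ≤ 1, so
  -- the finite control knows the answers to these inputs.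
  advice : ℕ → List Bool
  advice 0               = []
  advice 1               = []
  advice n@(suc (suc _)) = assemble (program n)

  answer : Maybe Bool → Bool
  answer nothing  = eval (Φ 0) []
  answer (just b) = eval (Φ 1) (b ∷ [])

  module _ {k} (states : Fin k ↔ State) where

    open Interpreter states answer

    halts : ∀ x → ∃[ i ] ∃[ h ]
      Star (_⟶_ x (advice (length x))) (starting , 0 , 0)
           (halt (eval (Φ (length x)) x) , i , h)
    halts []       = _ , _ , fire refl ◅ ε
    halts (b ∷ []) = _ , _ , fire refl ◅ fire refl ◅ ε
    halts x@(_ ∷ _ ∷ _) =
      let h , ss = interpret x (advice (length x)) (program (length x)) refl
          result = cong (λ (ρ , i) → halt (proj₁ ρ) , i , h)
                     (run-compile x (Φ (length x)) 0F false (false , true , false))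
      in _ , _ , fire refl ◅ fire refl ◅
                 subst (Star (_⟶_ x (advice (length x))) _) result ss

-- Size bounds

n<2^[⌊log₂n⌋+1] : ∀ n → n < 2 ^ (⌊log₂ n ⌋ + 1)
n<2^[⌊log₂n⌋+1] n with n <? 2 ^ (⌊log₂ n ⌋ + 1)
... | yes n< = n<
... | no n≮ = contradiction (subst (_≤ ⌊log₂ n ⌋) (⌊log₂[2^n]⌋≡n (⌊log₂ n ⌋ + 1))
                                     (⌊log₂⌋-mono-≤ (≮⇒≥ n≮)))
                             (<⇒≱ (m<m+n ⌊log₂ n ⌋ z<s))

PolyBound-< : ∀ c n → PolyBound c n < 2 ^ (1 + (⌊log₂ n ⌋ + 1) * c)
PolyBound-< c n = begin-strict
  n ^ c + c
    <⟨ +-mono-≤-< (^-monoˡ-≤ c (<⇒≤ (n<2^[⌊log₂n⌋+1] n))) (n<2^n c) ⟩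
  (2 ^ l) ^ c + 2 ^ c
    ≤⟨ +-mono-≤ (≤-reflexive (^-*-assoc 2 l c)) (^-monoʳ-≤ 2 (m≤n*m c l {{>-nonZero l>0}})) ⟩
  2 ^ (l * c) + 2 ^ (l * c)
    ≡⟨ cong (2 ^ (l * c) +_) (sym (+-identityʳ _)) ⟩
  2 ^ (1 + l * c) ∎
  where
  open ≤-Reasoning
  l = ⌊log₂ n ⌋ + 1
  l>0 : 0 < l
  l>0 = m≤n+m 1 ⌊log₂ n ⌋

-- The exponent of `size-accepted` as a function of the width alone.
exponent : ℕ → ℕ
exponent W = m * 3 + (m * (m * 3 + 2) + (3 + W))
  where m = W + (W + (W + (W + W)))

exponent-quadratic : ∀ W → 0 < W → 2 + exponent W ≤ 106 * (W * W)
exponent-quadratic (suc w) _ =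
  -- With `m = 5W` the left side is `75W² + 26W + 5`, and 75 + 26 + 5 = 106; the added term is the
  -- slack at `W = 1 + w`.
  ≤-trans (m≤m+n _ (36 * w + 31 * (w * w))) (≤-reflexive
    (solve 1 (λ w →
      let W = con 1 :+ w
          m = W :+ (W :+ (W :+ (W :+ W)))
      in con 2 :+ (m :* con 3 :+ (m :* (m :* con 3 :+ con 2) :+ (con 3 :+ W)))
           :+ (con 36 :* w :+ con 31 :* (w :* w))
         := con 106 :* (W :* W)) refl w))
  where open +-*-Solver using (solve; _:+_; _:*_; _:=_; con)

-- A constant factor `D` is absorbed into the exponent by `D ≤ 2 ^ D ≤ l ^ D`, which rests on
-- `2 ≤ l`. The summand 2 on the left pays for four advice bits per instruction.
exponent-≤ : ∀ K l → 0 < K → 2 ≤ l →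
             2 + exponent (K * l) ≤ l ^ (106 * (K * K) + 2)
exponent-≤ K l 0<K 2≤l = begin
  2 + exponent W
    ≤⟨ exponent-quadratic W (*-mono-≤ 0<K (≤-trans (s≤s z≤n) 2≤l)) ⟩
  106 * (W * W)
    ≡⟨ solve 2 (λ K l → con 106 :* (K :* l :* (K :* l))
                       := con 106 :* (K :* K) :* (l :* (l :* con 1))) refl K l ⟩
  D * l ^ 2
    ≤⟨ *-monoˡ-≤ (l ^ 2) (≤-trans (<⇒≤ (n<2^n D)) (^-monoˡ-≤ D 2≤l)) ⟩
  l ^ D * l ^ 2
    ≡⟨ sym (^-distribˡ-+-* l D 2) ⟩
  l ^ (D + 2) ∎
  where
  open ≤-Reasoning
  open +-*-Solver using (solve; _:+_; _:*_; _:=_; con)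
  W = K * l
  D = 106 * (K * K)

length-program : ∀ (Φ : ∀ n → Formula n) n e → size (Φ n) ≤ 2 ^ e →
                 length (assemble (program Φ n)) ≤ 2 ^ (2 + e)
length-program Φ n e size≤ = begin
  length (assemble (program Φ n)) ≡⟨ length-assemble (program Φ n) ⟩
  length (program Φ n) * 4        ≤⟨ *-monoˡ-≤ 4 (≤-trans (length-compile (Φ n) _ _) size≤) ⟩
  2 ^ e * 4                       ≡⟨ *-comm (2 ^ e) 4 ⟩
  4 * 2 ^ e                       ≡⟨ *-assoc 2 2 (2 ^ e) ⟩
  2 ^ (2 + e)                     ∎
  where open ≤-Reasoning

-- Choice of the width and the resulting advice

module Simulation (M : TM) (c : ℕ) (α : ℕ → List Bool)
  (α≤ : ∀ n → length (α n) ≤ PolyBound c n) (space : LogSpaceWith M c α) where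

  -- Large enough that the width `K * l` accommodates the states (`Q M ≤ K`) as well as the advice
  -- head and the work space (`c < K`).
  K : ℕ
  K = Q M + 2 * c + 2

  module _ (n : ℕ) where

    l W : ℕ
    l = ⌊log₂ n ⌋ + 1
    W = K * l

    0<l : 0 < l
    0<l = m≤n+m 1 ⌊log₂ n ⌋

    c<K : c < K
    c<K = begin-strict
      c               ≤⟨ m≤m+n c (c + 0) ⟩
      2 * c           ≤⟨ m≤n+m (2 * c) (Q M) ⟩
      Q M + 2 * c     <⟨ m<m+n _ z<s ⟩
      K               ∎
      where open ≤-Reasoning

    K≤W : K ≤ W
    K≤W = m≤m*n K l {{>-nonZero 0<l}}

    states≤ : Q M ≤ 2 ^ W
    states≤ = ≤-trans (≤-trans (m≤m+n (Q M) (2 * c)) (m≤m+n _ 2))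
                      (≤-trans K≤W (<⇒≤ (n<2^n W)))

    input< : n < 2 ^ W
    input< = <-≤-trans (n<2^[⌊log₂n⌋+1] n)
      (^-monoʳ-≤ 2 (m≤n*m l K {{>-nonZero (≤-trans (s≤s z≤n) c<K)}}))

    advice< : length (α n) < 2 ^ W
    advice< = ≤-<-trans (α≤ n) (<-≤-trans (PolyBound-< c n) (^-monoʳ-≤ 2 (begin
      1 + l * c   ≤⟨ +-monoˡ-≤ (l * c) 0<l ⟩
      l + l * c   ≡⟨ cong (l +_) (*-comm l c) ⟩
      suc c * l   ≤⟨ *-monoˡ-≤ l c<K ⟩
      W           ∎)))
      where open ≤-Reasoning

    space< : c * ⌊log₂ n ⌋ + c < W
    space< = begin-strict
      c * ⌊log₂ n ⌋ + c      ≡⟨ cong (c * ⌊log₂ n ⌋ +_) (sym (*-identityʳ c)) ⟩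
      c * ⌊log₂ n ⌋ + c * 1  ≡⟨ sym (*-distribˡ-+ c ⌊log₂ n ⌋ 1) ⟩
      c * l                  <⟨ *-monoˡ-< l {{>-nonZero 0<l}} c<K ⟩
      W                      ∎
      where open ≤-Reasoning

  Φ : ∀ n → Formula n
  Φ n = ConfigurationGraph.accepted M (α n) (W n) n

  Φ-sound : ∀ x → eval (Φ (length x)) x ≡ true → Accepts M x (α (length x))
  Φ-sound x = accepted-sound M x (α n) (W n)
    (states≤ n) (input< n) (advice< n) (λ C r → ≤-<-trans (space x C r) (space< n))
    where n = length x

  Φ-complete : ∀ x → Accepts M x (α (length x)) → eval (Φ (length x)) x ≡ true
  Φ-complete x = accepted-complete M x (α n) (W n)
    (states≤ n) (input< n) (advice< n) (λ C r → ≤-<-trans (space x C r) (space< n))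
    where n = length x

  d : ℕ
  d = 106 * (K * K) + 2

  advice-≤ : ∀ n → length (advice Φ n) ≤ QuasiPolyBound d n
  advice-≤ 0 = z≤n
  advice-≤ 1 = z≤n
  advice-≤ n@(suc (suc _)) =
    ≤-trans (length-program Φ n (exponent (W n))
               (ConfigurationGraph.size-accepted M (α n) (W n) n (input< n)))
      (^-monoʳ-≤ 2 (exponent-≤ K (l n) (≤-trans (s≤s z≤n) (c<K n)) 2≤l))
    where
    2≤l : 2 ≤ l n
    2≤l = +-monoˡ-≤ 1 (⌊log₂⌋-mono-≤ {2} {n} (s≤s (s≤s z≤n)))

theorem4 : (A : Language) → InNLpoly A → InLquasipoly A
theorem4 A (M , c , α , α≤ , space , decides) =
  machine , d , advice Φ , machine-deterministic , advice-≤ ,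
  -- The work head never leaves cell 0, so any space bound holds.
  (λ x C r → subst (_≤ _) (sym (whead≡0 x _ r refl)) z≤n) ,
  λ x → let i , h , ss = halts Φ (proj₂ State-finite) x
            open Equivalence (accepts⇔ x _ ss)
        in to ∘ Φ-complete x ∘ proj₁ (decides x) ,
           proj₂ (decides x) ∘ Φ-sound x ∘ from
  where
  open Simulation M c α α≤ space
  open Interpreter (proj₂ State-finite) (answer Φ)
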